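{- Strong bisimilarity is strictly finer than each of strong direct simulation equivalence, stuttering bisimilarity and governed bisimilarity. That is, for each relation $\approx$ among these three: in every parity game, strongly bisimilar vertices $v,w$ satisfy $v\approx w$; and there is a parity game with vertices $v,w$ such that $v\approx w$ but $v,w$ are not strongly bisimilar.
   Context: A parity game is a tuple $(V,\to,\Omega,\mathcal P)$ where $V$ is a finite set of vertices, $\to\subseteq V\times V$ is total (every vertex has at least one successor), $\Omega:V\to\mathbb N$ is a priority function, and $\mathcal P:V\to\{\Diamond,\Box\}$ assigns each vertex to player even ($\Diamond$) or odd ($\Box$). Write $V_\Diamond,V_\Box$ for the vertices owned by each player and $v^\bullet=\{w\mid v\to w\}$. Governed and strong bisimilarity: a symmetric $R\subseteq V\times V$ is a governed bisimulation iff $v\,R\,w$ implies: (1) $\Omega(v)=\Omega(w)$; (2) if $\mathcal P(v)\neq\mathcal P(w)$, then $v'\,R\,w'$ for all $v'\in v^\bullet$, $w'\in w^\bullet$; (3) for all $v'\in v^\bullet$ there is $w'\in w^\bullet$ with $v'\,R\,w'$. A strong bisimulation is a governed bisimulation that only relates vertices with the same owner. Vertices are governed (resp. strongly) bisimilar iff some governed (resp. strong) bisimulation relates them. Strong direct simulation equivalence: $v\to_i T$ (one-step forcing) means: either $\mathcal P(v)=i$ and $v^\bullet\cap T\neq\emptyset$, or $\mathcal P(v)\neq i$ and $v^\bullet\subseteq T$. Put $vR=\{w\mid v\,R\,w\}$, $UR=\bigcup_{u\in U}uR$. $R\subseteq V\times V$ is a direct simulation iff $v\,R\,w$ implies $\Omega(v)=\Omega(w)$;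 if $v\in V_\Diamond$ then $w\to_\Diamond v'R$ for each $v'\in v^\bullet$; if $v\in V_\Box$ then $w\to_\Diamond v^\bullet R$. A strong direct simulation is a direct simulation that only relates vertices with the same owner. $v\leq_{sd}w$ iff some strong direct simulation relates $v$ to $w$; $v,w$ are strong direct simulation equivalent iff $v\leq_{sd}w$ and $w\leq_{sd}v$. Stuttering bisimilarity: a memoryless strategy for player $i$ is a partial function $\sigma:V\to V$ defined only on vertices owned by $i$, with $v\to\sigma(v)$ whenever defined; it allows an infinite path $v_0v_1\dots$ iff $v_{j+1}=\sigma(v_j)$ whenever $\sigma(v_j)$ is defined. $v\mapsto_{i,U}T$ iff there is a memoryless strategy $\sigma$ for $i$ such that every infinite path $v_0v_1\dots$ with $v_0=v$ allowed by $\sigma$ has some $n$ with $v_n\in T$ and $v_j\in U$ for all $j<n$. $v\mapsto_{i,U}$ iff there is such $\sigma$ for which every infinite path from $v$ allowed by $\sigma$ stays in $U$ forever. An equivalence relation $R$ on $V$ is a governed stuttering bisimulation iff $v\,R\,w$ implies: (a) $\Omega(v)=\Omega(w)$; (b) for all $R$-classes $\mathcal C\neq[v]_R$, if $v$ has a successor in $\mathcal C$ then $w\mapsto_{\mathcal P(v),[w]_R}\mathcal C$; (c) for each player $i$, $v\mapsto_{i,[v]_R}$ implies $w\mapsto_{i,[w]_R}$. A stuttering bisimulation is a governed stuttering bisimulation that only relates vertices with the same owner. Vertices are stuttering bisimilar iff some stuttering bisimulation relates them. -}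

module Defs where

open import Data.Fin.Base using (Fin)
open import Data.Maybe.Base using (Maybe; just)
open import Data.Nat.Base using (ℕ; zero; suc; _<_)
open import Data.Product using (Σ-syntax; ∃-syntax; _×_)
open import Data.Sum.Base using (_⊎_)
open import Function.Bundles using (_↔_)
open import Level using (0ℓ)
open import Relation.Binary.Core using (Rel)
open import Relation.Binary.Definitions using (Decidable; Symmetric)
open import Relation.Binary.PropositionalEquality using (_≡_; _≢_)
open import Relation.Binary.Structures using (IsEquivalence)
open import Relation.Nullary.Negation using (¬_)
open import Relation.Unary using (Pred; _∈_; _⊆_; _∩_; _≐_; Satisfiable)

data Player : Set where
  ◇ □ : Player

-- Decidability of _⟶_ is part of "finite game": classically it is automatic.
record ParityGame : Set₁ where
  infix 4 _⟶_ _⟶?_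
  field
    V      : Set
    size   : ℕ
    finite : V ↔ Fin size
    _⟶_    : Rel V 0ℓ
    _⟶?_   : Decidable _⟶_
    total  : ∀ v → ∃[ w ] v ⟶ w
    Ω      : V → ℕ
    𝒫      : V → Player

module _ (G : ParityGame) where
  open ParityGame G

  -- For R : Rel V 0ℓ, the set vR is the partial application R v; when R is an
  -- equivalence this is also the class [v]_R.

  infix 9 _•
  _• : V → Pred V 0ℓ
  v • = v ⟶_

  image : Pred V 0ℓ → Rel V 0ℓ → Pred V 0ℓ
  image U R w = ∃[ u ] (u ∈ U × R u w)

  SameOwner : Rel V 0ℓ → Set
  SameOwner R = ∀ {v w} → R v w → 𝒫 v ≡ 𝒫 w

  record IsGovernedBisimulation (R : Rel V 0ℓ) : Set where
    field
      symmetric : Symmetric R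
      priority  : ∀ {v w} → R v w → Ω v ≡ Ω w
      governed  : ∀ {v w} → R v w → 𝒫 v ≢ 𝒫 w →
                  ∀ {v′ w′} → v′ ∈ v • → w′ ∈ w • → R v′ w′
      transfer  : ∀ {v w} → R v w →
                  ∀ {v′} → v′ ∈ v • → ∃[ w′ ] (w′ ∈ w • × R v′ w′)

  IsStrongBisimulation : Rel V 0ℓ → Set
  IsStrongBisimulation R = IsGovernedBisimulation R × SameOwner R

  Forces : Player → V → Pred V 0ℓ → Set
  Forces i v T = (𝒫 v ≡ i × Satisfiable (v • ∩ T))
               ⊎ (𝒫 v ≢ i × v • ⊆ T)

  record IsDirectSimulation (R : Rel V 0ℓ) : Set where
    field
      priority : ∀ {v w} → R v w → Ω v ≡ Ω w
      even     : ∀ {v w} → R v w → 𝒫 v ≡ ◇ →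
                 ∀ {v′} → v′ ∈ v • → Forces ◇ w (R v′)
      odd      : ∀ {v w} → R v w → 𝒫 v ≡ □ → Forces ◇ w (image (v •) R)

  IsStrongDirectSimulation : Rel V 0ℓ → Set
  IsStrongDirectSimulation R = IsDirectSimulation R × SameOwner R

  record Strategy (i : Player) : Set where
    field
      σ     : V → Maybe V
      owned : ∀ {v w} → σ v ≡ just w → 𝒫 v ≡ i
      valid : ∀ {v w} → σ v ≡ just w → v ⟶ w

  record AllowedPath {i : Player} (S : Strategy i) (v : V) : Set where
    open Strategy S
    field
      at      : ℕ → V
      start   : at zero ≡ v
      step    : ∀ j → at j ⟶ at (suc j)
      allowed : ∀ j {w} → σ (at j) ≡ just w → at (suc j) ≡ w

  -- v ↦_{i,U} T
  ForcesTo : Player → Pred V 0ℓ → V → Pred V 0ℓ → Set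
  ForcesTo i U v T =
    Σ[ S ∈ Strategy i ] ((p : AllowedPath S v) → let open AllowedPath p in
      ∃[ n ] (at n ∈ T × (∀ j → j < n → at j ∈ U)))

  -- v ↦_{i,U}
  ForcesStay : Player → Pred V 0ℓ → V → Set
  ForcesStay i U v =
    Σ[ S ∈ Strategy i ] ((p : AllowedPath S v) → let open AllowedPath p in
      ∀ j → at j ∈ U)

  -- In leave, the class 𝒞 is given by a representative c, i.e. 𝒞 = R c.
  record IsGovernedStutteringBisimulation (R : Rel V 0ℓ) : Set where
    field
      isEquivalence : IsEquivalence R
      priority : ∀ {v w} → R v w → Ω v ≡ Ω w
      leave    : ∀ {v w} → R v w → ∀ c → ¬ (R c ≐ R v) →
                 Satisfiable (v • ∩ R c) → ForcesTo (𝒫 v) (R w) w (R c)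
      stay     : ∀ {v w} → R v w → ∀ i →
                 ForcesStay i (R v) v → ForcesStay i (R w) w

  IsStutteringBisimulation : Rel V 0ℓ → Set
  IsStutteringBisimulation R = IsGovernedStutteringBisimulation R × SameOwner R

  GovernedBisimilar : V → V → Set₁
  GovernedBisimilar v w = ∃[ R ] (IsGovernedBisimulation R × R v w)

  StronglyBisimilar : V → V → Set₁
  StronglyBisimilar v w = ∃[ R ] (IsStrongBisimulation R × R v w)

  _≤sd_ : V → V → Set₁
  v ≤sd w = ∃[ R ] (IsStrongDirectSimulation R × R v w)

  StrongDirectSimulationEquivalent : V → V → Set₁
  StrongDirectSimulationEquivalent v w = v ≤sd w × w ≤sd v

  StutteringBisimilar : V → V → Set₁
  StutteringBisimilar v w = ∃[ R ] (IsStutteringBisimulation R × R v w)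

VertexRelation : Set₂
VertexRelation = (G : ParityGame) → let open ParityGame G in V → V → Set₁

StrictlyFiner : VertexRelation → VertexRelation → Set₁
StrictlyFiner A B =
    (∀ G v w → A G v w → B G v w)
  × (∃[ G ] ∃[ v ] ∃[ w ] (B G v w × ¬ A G v w))

{-# OPTIONS --safe #-}

-- A strong bisimulation is itself a strong direct simulation, and its reflexive
-- transitive closure is a stuttering bisimulation.  Only preservation of
-- "can stay in the class" takes an argument, because classes need not be
-- decidable and a memoryless strategy must be defined on all of V: if the class
-- is owned by the player, follow successors inside it until a vertex repeats
-- and play along the resulting lasso; otherwise every successor of every vertex
-- of the class is in the class, and the empty strategy works.
module Submission where

open import Defs
open import Data.Empty using (⊥-elim)
open import Data.Fin.Base using (Fin; toℕ)
open import Data.Fin.Patterns using (0F; 1F; 2F; 3F)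
import Data.Fin.Properties as Fin
open import Data.List.Membership.DecPropositional using (_∈?_)
import Data.List.Membership.Propositional as List
open import Data.List.NonEmpty.Base using (List⁺; _∷_; toList; [_])
open import Data.List.Base using ([]; _∷_)
open import Data.List.Relation.Unary.Any using (here; there)
open import Data.Maybe.Base using (Maybe; just; nothing)
open import Data.Maybe.Properties using (just-injective)
open import Data.Nat.Base using (ℕ; zero; suc; _<_; s≤s)
open import Data.Nat.Properties using (anyUpTo?; n<1+n; m≤n⇒m<n∨m≡n; m<n⇒0<n)
open import Data.Product using (Σ; Σ-syntax; ∃-syntax; _×_; _,_; proj₁; proj₂)
open import Data.Sum.Base using (inj₁; inj₂)
open import Data.Unit.Base using (⊤; tt)
open import Function.Base using (_∘_; _on_)
open import Function.Bundles using (module Injection)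
open import Function.Construct.Identity using (↔-id)
open import Function.Properties.Inverse using (↔⇒↣)
open import Level using (0ℓ)
open import Relation.Binary.Construct.Closure.ReflexiveTransitive
  using (Star; ε; _◅_; _◅◅_; fold; reverse)
import Relation.Binary.Construct.On as On
open import Relation.Binary.Core using (Rel)
open import Relation.Binary.Definitions using (DecidableEquality)
open import Relation.Binary.PropositionalEquality
  using (_≡_; refl; sym; trans; cong; subst; isEquivalence)
open import Relation.Binary.Structures using (IsEquivalence)
open import Relation.Nullary.Decidable.Core using (Dec; yes; no)
open import Relation.Nullary.Negation using (¬_)
open import Relation.Unary using (Pred; _∈_; _∩_; Satisfiable; Decidable)

_≟ᴾ_ : DecidableEquality Player
◇ ≟ᴾ ◇ = yes refl
◇ ≟ᴾ □ = no λ ()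
□ ≟ᴾ ◇ = no λ ()
□ ≟ᴾ □ = yes refl

module _ {G : ParityGame} where
  open ParityGame G

  _≟ⱽ_ : DecidableEquality V
  _≟ⱽ_ = Fin.inj⇒≟ (↔⇒↣ finite)

  emptyStrategy : ∀ {i} → Strategy G i
  emptyStrategy = record { σ = λ _ → nothing ; owned = λ () ; valid = λ () }

  -- Memoryless strategies with a decidable domain.

  module Choice {i : Player} {D : Pred V 0ℓ} (D? : Decidable D)
                (owned : ∀ {u} → u ∈ D → 𝒫 u ≡ i)
                (choose : ∀ {u} → u ∈ D → ∃[ u′ ] u ⟶ u′) where

    choice : ∀ {u} → Dec (u ∈ D) → Maybe V
    choice (yes d) = just (proj₁ (choose d))
    choice (no  _) = nothing

    choice-just : ∀ {u w} (d? : Dec (u ∈ D)) → choice d? ≡ just w →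
                  Σ[ d ∈ u ∈ D ] proj₁ (choose d) ≡ w
    choice-just (yes d) eq = d , just-injective eq

    choice-∈ : ∀ {u} (d? : Dec (u ∈ D)) → u ∈ D →
               Σ[ d ∈ u ∈ D ] choice d? ≡ just (proj₁ (choose d))
    choice-∈ (yes d) _ = d , refl
    choice-∈ (no ¬d) d = ⊥-elim (¬d d)

    strategy : Strategy G i
    strategy = record
      { σ     = λ u → choice (D? u)
      ; owned = λ {u} eq → owned (proj₁ (choice-just (D? u) eq))
      ; valid = λ {u} eq → let d , e = choice-just (D? u) eq
                           in subst (u ⟶_) e (proj₂ (choose d))
      }

    -- The move is computed from the membership proof returned by `D?`. This may differ from the
    -- given one and lead elsewhere, so the result names its own proof.
    follows : ∀ {v} (p : AllowedPath G strategy v) → let open AllowedPath p in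
              ∀ j → at j ∈ D → Σ[ d ∈ at j ∈ D ] at (suc j) ≡ proj₁ (choose d)
    follows p j d = let open AllowedPath p
                        d′ , eq = choice-∈ (D? (at j)) d
                    in d′ , allowed j eq

  -- A strategy defined at `w` alone suffices: `T` is reached at position 1, so only position 0 has
  -- to lie in `U`.
  forcesTo-successor : ∀ {i U T w w′} → 𝒫 w ≡ i → w ⟶ w′ → w ∈ U → w′ ∈ T →
                       ForcesTo G i U w T
  forcesTo-successor {i} {U} {T} {w} {w′} own w⟶w′ w∈U w′∈T =
    strategy , λ p → let open AllowedPath p in
      1 , arrives (follows p 0 (sym start))
        , λ where zero _ → subst U (sym start) w∈U
                  (suc _) (s≤s ())
    where
    choose : ∀ {u} → w ≡ u → ∃[ u′ ] u ⟶ u′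
    choose refl = w′ , w⟶w′

    owned : ∀ {u} → w ≡ u → 𝒫 u ≡ i
    owned refl = own

    open Choice (w ≟ⱽ_) owned choose

    arrives : ∀ {u x} → Σ[ d ∈ w ≡ u ] x ≡ proj₁ (choose d) → x ∈ T
    arrives (refl , refl) = w′∈T

  -- Staying in a set by playing along a lasso.

  module Lasso {P : Pred V 0ℓ}
               (successor : ∀ {u} → u ∈ P → Satisfiable (_• G u ∩ P))
               {w : V} (w∈P : w ∈ P) where

    walk : ℕ → Σ V P
    walk zero    = w , w∈P
    walk (suc n) = let u′ , _ , u′∈P = successor (proj₂ (walk n)) in u′ , u′∈P

    vertex : ℕ → V
    vertex n = proj₁ (walk n)

    vertex-step : ∀ n → vertex n ⟶ vertex (suc n)
    vertex-step n = proj₁ (proj₂ (successor (proj₂ (walk n))))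

    -- The walk at equal vertices may continue differently, as successor depends
    -- on the membership proof; so only its part before the repetition is used.
    repetition : ∃[ m ] ∃[ n ] (m < n × vertex m ≡ vertex n)
    repetition with Fin.pigeonhole (n<1+n size) (Injection.to (↔⇒↣ finite) ∘ vertex ∘ toℕ)
    ... | m , n , m<n , eq = toℕ m , toℕ n , m<n , Injection.injective (↔⇒↣ finite) eq

    end : ℕ
    end = proj₁ (proj₂ repetition)

    -- The bound on the index makes membership a finite search, hence decidable even if `P` is not.
    OnLasso : Pred V 0ℓ
    OnLasso u = ∃[ k ] (k < end × vertex k ≡ u)

    onLasso? : Decidable OnLasso
    onLasso? u = anyUpTo? (λ k → vertex k ≟ⱽ u) end

    onLasso-start : w ∈ OnLasso
    onLasso-start = 0 , m<n⇒0<n (proj₁ (proj₂ (proj₂ repetition))) , refl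

    onLasso-suc : ∀ {k} → k < end → vertex (suc k) ∈ OnLasso
    onLasso-suc k<end with m≤n⇒m<n∨m≡n k<end
    ... | inj₁ 1+k<end = _ , 1+k<end , refl
    -- The next vertex is `vertex end`, which repeats the earlier `vertex m`: the lasso closes.
    ... | inj₂ 1+k≡end = let m , _ , m<n , eq = repetition in
                         m , m<n , trans eq (cong vertex (sym 1+k≡end))

    onLasso⇒∈ : ∀ {u} → u ∈ OnLasso → u ∈ P
    onLasso⇒∈ (k , _ , refl) = proj₂ (walk k)

    choose : ∀ {u} → u ∈ OnLasso → ∃[ u′ ] u ⟶ u′
    choose (k , _ , refl) = vertex (suc k) , vertex-step k

    -- Whichever index below `end` the membership proof carries, the move goes to the following
    -- position of the walk.
    choose-closed : ∀ {u x} → Σ[ d ∈ u ∈ OnLasso ] x ≡ proj₁ (choose d) → x ∈ OnLasso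
    choose-closed ((_ , k<end , refl) , refl) = onLasso-suc k<end

    forcesStay : ∀ {i} → (∀ {u} → u ∈ P → 𝒫 u ≡ i) → ForcesStay G i P w
    forcesStay own = strategy , λ p j → onLasso⇒∈ (stays p j)
      where
      open Choice onLasso? (own ∘ onLasso⇒∈) choose

      stays : (p : AllowedPath G strategy w) → ∀ j → AllowedPath.at p j ∈ OnLasso
      stays p zero    = subst OnLasso (sym (AllowedPath.start p)) onLasso-start
      stays p (suc j) = choose-closed (follows p j (stays p j))

  forcesStay-closed : ∀ {i} {P : Pred V 0ℓ} {w} →
                      (∀ {u u′} → u ∈ P → u ⟶ u′ → u′ ∈ P) → w ∈ P → ForcesStay G i P w
  forcesStay-closed {P = P} {w} closed w∈P = emptyStrategy , stays
    where
    stays : (p : AllowedPath G emptyStrategy w) → ∀ j → AllowedPath.at p j ∈ P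
    stays p zero    = subst P (sym (AllowedPath.start p)) w∈P
    stays p (suc j) = closed (stays p j) (AllowedPath.step p j)

  -- Existence of paths allowed by a strategy.

  module _ {i : Player} (S : Strategy G i) where
    open Strategy S

    Allows : Rel V 0ℓ
    Allows v v′ = v ⟶ v′ × (∀ {x} → σ v ≡ just x → v′ ≡ x)

    allowedSuccessor : ∀ v → ∃[ v′ ] Allows v v′
    allowedSuccessor v with σ v in eq
    ... | just x  = x , valid eq , just-injective
    ... | nothing = let v′ , v⟶v′ = total v in v′ , v⟶v′ , λ ()

    -- The first step is a parameter, so that a path can be sent through any chosen allowed
    -- successor.
    allowedPath : ∀ {v v′} → Allows v v′ → AllowedPath G S v
    allowedPath {v} {v′} a = record
      { at      = at
      ; start   = refl
      ; step    = λ j → proj₁ (allows j)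
      ; allowed = λ j → proj₂ (allows j)
      }
      where
      at : ℕ → V
      at zero          = v
      at (suc zero)    = v′
      at (suc (suc n)) = proj₁ (allowedSuccessor (at (suc n)))

      allows : ∀ j → Allows (at j) (at (suc j))
      allows zero    = a
      allows (suc j) = proj₂ (allowedSuccessor (at (suc j)))

  module _ {i : Player} (U : Pred V 0ℓ) {v : V} where

    forcesStay⇒successor : ForcesStay G i U v → Satisfiable (_• G v ∩ U)
    forcesStay⇒successor (S , stays) =
      let v′ , a = allowedSuccessor S v in v′ , proj₁ a , stays (allowedPath S a) 1

    -- A strategy for `i` prescribes nothing at a vertex of the opponent, so every edge out of `v`
    -- begins an allowed path.
    forcesStay⇒successors : ¬ (𝒫 v ≡ i) → ForcesStay G i U v → ∀ {v′} → v ⟶ v′ → v′ ∈ U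
    forcesStay⇒successors ¬own (S , stays) v⟶v′ =
      stays (allowedPath S (v⟶v′ , λ eq → ⊥-elim (¬own (Strategy.owned S eq)))) 1

  -- From strong bisimulations to the coarser notions.

  strong⇒directSimulation : ∀ {R} → IsStrongBisimulation G R → IsStrongDirectSimulation G R
  strong⇒directSimulation (R-bisim , same) = record
    { priority = priority
    ; even     = λ r v◇ v⟶v′ → inj₁ (trans (sym (same r)) v◇ , transfer r v⟶v′)
    -- Here the opponent moves at `w`, so each edge of `w` is matched backwards by symmetry.
    ; odd      = λ r v□ → inj₂ ( (λ w◇ → ◇≢□ (trans (sym w◇) (trans (sym (same r)) v□)))
                               , λ w⟶w′ → let v′ , v⟶v′ , r′ = transfer (symmetric r) w⟶w′
                                          in v′ , v⟶v′ , symmetric r′)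
    } , same
    where
    open IsGovernedBisimulation R-bisim

    ◇≢□ : ¬ (◇ ≡ □)
    ◇≢□ ()

  -- Stuttering bisimulations must be equivalences; the closure supplies reflexivity and
  -- transitivity.
  star-strong : ∀ {R} → IsStrongBisimulation G R → IsStrongBisimulation G (Star R)
  star-strong {R} (R-bisim , same) = record
    { symmetric = reverse symmetric
    ; priority  = fold (λ v w → Ω v ≡ Ω w) (λ r eq → trans (priority r) eq) refl
    ; governed  = λ rs v≢w → ⊥-elim (v≢w (same* rs))
    ; transfer  = transfer*
    } , same*
    where
    open IsGovernedBisimulation R-bisim

    same* : SameOwner G (Star R)
    same* = fold (λ v w → 𝒫 v ≡ 𝒫 w) (λ r eq → trans (same r) eq) refl

    transfer* : ∀ {v w} → Star R v w → ∀ {v′} → v ⟶ v′ → ∃[ w′ ] (w ⟶ w′ × Star R v′ w′)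
    transfer* ε        v⟶v′ = _ , v⟶v′ , ε
    transfer* (r ◅ rs) v⟶v′ =
      let u′ , u⟶u′ , r′  = transfer r v⟶v′
          w′ , w⟶w′ , rs′ = transfer* rs u⟶u′
      in w′ , w⟶w′ , r′ ◅ rs′

  strong⇒stuttering : ∀ {R} → IsEquivalence R → IsStrongBisimulation G R →
                      IsStutteringBisimulation G R
  strong⇒stuttering {R} R-equiv (R-bisim , same) = record
    { isEquivalence = R-equiv
    ; priority      = priority
    -- The matching edge of `w` enters the class of `c` at once, and `w` has the owner of `v`.
    ; leave         = λ r c _ (v′ , v⟶v′ , c~v′) →
        let w′ , w⟶w′ , r′ = transfer r v⟶v′
        in forcesTo-successor {U = R _} {T = R c} (sym (same r)) w⟶w′ ≈.refl (≈.trans c~v′ r′)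
    ; stay          = stay
    } , same
    where
    open IsGovernedBisimulation R-bisim
    module ≈ = IsEquivalence R-equiv

    stay : ∀ {v w} → R v w → ∀ i → ForcesStay G i (R v) v → ForcesStay G i (R w) w
    stay {v} {w} r i forces with 𝒫 v ≟ᴾ i
    ... | yes own = Lasso.forcesStay successor ≈.refl λ wRu → trans (sym (same (≈.trans r wRu))) own
      where
      -- One edge of `v` inside the class is matched from every vertex of the class.
      successor : ∀ {u} → R w u → Satisfiable (_• G u ∩ R w)
      successor wRu =
        let v′ , v⟶v′ , vRv′ = forcesStay⇒successor (R v) forces
            u′ , u⟶u′ , v′Ru′ = transfer (≈.trans r wRu) v⟶v′
        in u′ , u⟶u′ , ≈.trans (≈.sym r) (≈.trans vRv′ v′Ru′)
    ... | no ¬own = forcesStay-closed closed ≈.refl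
      where
      -- Matching runs the other way: an edge of `u` is answered by one of `v`, and all of those
      -- stay in the class.
      closed : ∀ {u u′} → R w u → u ⟶ u′ → R w u′
      closed wRu u⟶u′ =
        let v′ , v⟶v′ , u′Rv′ = transfer (≈.sym (≈.trans r wRu)) u⟶u′
            vRv′ = forcesStay⇒successors (R v) ¬own forces v⟶v′
        in ≈.trans (≈.sym r) (≈.trans vRv′ (≈.sym u′Rv′))

  strong⇒≤sd : ∀ {v w} → StronglyBisimilar G v w → _≤sd_ G v w
  strong⇒≤sd (R , R-strong , r) = R , strong⇒directSimulation R-strong , r

  stronglyBisimilar-sym : ∀ {v w} → StronglyBisimilar G v w → StronglyBisimilar G w v
  stronglyBisimilar-sym (R , R-strong , r) =
    R , R-strong , IsGovernedBisimulation.symmetric (proj₁ R-strong) r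

  strong⇒stutteringBisimilar : ∀ {v w} → StronglyBisimilar G v w → StutteringBisimilar G v w
  strong⇒stutteringBisimilar (R , R-strong , r) =
    Star R , strong⇒stuttering star-equiv (star-strong R-strong) , r ◅ ε
    where
    star-equiv : IsEquivalence (Star R)
    star-equiv = record
      { refl  = ε
      ; sym   = reverse (IsGovernedBisimulation.symmetric (proj₁ R-strong))
      ; trans = _◅◅_
      }

-- Games that separate the relations.

game : ∀ n → (Fin n → List⁺ (Fin n)) → (Fin n → ℕ) → (Fin n → Player) → ParityGame
game n successors Ω 𝒫 = record
  { V      = Fin n
  ; size   = n
  ; finite = ↔-id (Fin n)
  ; _⟶_    = λ v w → w List.∈ toList (successors v)
  ; _⟶?_   = λ v w → _∈?_ Fin._≟_ w (toList (successors v))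
  ; total  = λ v → List⁺.head (successors v) , here refl
  ; Ω      = Ω
  ; 𝒫      = 𝒫
  }

-- The option 0F → 2F is dominated by 0F → 3F, because 2F is simulated by 3F;
-- only 3F can return to priority 1, so they are not bisimilar.
dominated : ParityGame
dominated = game 4 successors Ω (λ _ → ◇)
  where
  successors : Fin 4 → List⁺ (Fin 4)
  successors 0F = 2F ∷ 3F ∷ []
  successors 1F = [ 3F ]
  successors 2F = [ 2F ]
  successors 3F = 0F ∷ 2F ∷ []

  Ω : Fin 4 → ℕ
  Ω 0F = 1
  Ω 1F = 1
  Ω 2F = 0
  Ω 3F = 0

-- This one relation serves both directions of the equivalence of `0F` and `1F`.
data Dominates : Rel (Fin 4) 0ℓ where
  same  : ∀ {v} → Dominates v v
  0F≤1F : Dominates 0F 1F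
  1F≤0F : Dominates 1F 0F
  2F≤3F : Dominates 2F 3F

dominates-simulation : IsStrongDirectSimulation dominated Dominates
dominates-simulation = record
  { priority = λ where
      same  → refl
      0F≤1F → refl
      1F≤0F → refl
      2F≤3F → refl
  ; even     = λ r _ v⟶v′ → inj₁ (refl , transfer r v⟶v′)
  ; odd      = λ _ ()
  } , λ _ → refl
  where
  open ParityGame dominated using (_⟶_)

  transfer : ∀ {v w} → Dominates v w → ∀ {v′} → v ⟶ v′ → ∃[ w′ ] (w ⟶ w′ × Dominates v′ w′)
  transfer same  v⟶v′                = _ , v⟶v′ , same
  transfer 0F≤1F (here refl)         = 3F , here refl , 2F≤3F
  transfer 0F≤1F (there (here refl)) = 3F , here refl , same
  transfer 1F≤0F (here refl)         = 3F , there (here refl) , same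
  transfer 2F≤3F (here refl)         = 2F , there (here refl) , same

-- Only `1F` to `3F` can match `0F` to `2F`. By symmetry the loop at `2F` must then match `3F` to
-- `0F`, against the priorities.
dominated-not-strong : ¬ StronglyBisimilar dominated 0F 1F
dominated-not-strong (R , (R-bisim , _) , r)
  with transfer r {2F} (here refl)
  where open IsGovernedBisimulation R-bisim
... | _ , here refl , r′ with transfer (symmetric r′) {0F} (here refl)
  where open IsGovernedBisimulation R-bisim
... | _ , here refl , r″ with () ← IsGovernedBisimulation.priority R-bisim r″

-- Stuttering ignores how many steps of priority 0 precede the loop of priority 1; strong
-- bisimilarity counts them.
chain : ParityGame
chain = game 3 successors Ω (λ _ → ◇)
  where
  successors : Fin 3 → List⁺ (Fin 3)
  successors 0F = [ 1F ]
  successors 1F = [ 2F ]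
  successors 2F = [ 2F ]

  Ω : Fin 3 → ℕ
  Ω 0F = 0
  Ω 1F = 0
  Ω 2F = 1

module Chain where
  open ParityGame chain using (_⟶_; Ω)

  SamePriority : Rel (Fin 3) 0ℓ
  SamePriority = _≡_ on Ω

  module _ {i : Player} {S : Strategy chain i} where
    open AllowedPath

    -- Each vertex has a single successor, so positions do not depend on the strategy.
    from-0F : (p : AllowedPath chain S 0F) → at p 1 ≡ 1F
    from-0F p with at p 0 | start p | at p 1 | step p 0
    ... | _ | refl | _ | here refl = refl

    from-1F : (p : AllowedPath chain S 1F) → at p 1 ≡ 2F
    from-1F p with at p 0 | start p | at p 1 | step p 0
    ... | _ | refl | _ | here refl = refl

    from-0F² : (p : AllowedPath chain S 0F) → at p 2 ≡ 2F
    from-0F² p with at p 1 | from-0F p | at p 2 | step p 1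
    ... | _ | refl | _ | here refl = refl

    path : ∀ v → AllowedPath chain S v
    path v = allowedPath S (proj₂ (allowedSuccessor S v))

  leave-0F : ∀ {i c} → Ω c ≡ 1 → ForcesTo chain i (SamePriority 0F) 0F (SamePriority c)
  leave-0F c≡1 = emptyStrategy , λ p → 2 , trans c≡1 (cong Ω (sym (from-0F² p))) , λ where
    0 _ → cong Ω (sym (AllowedPath.start p))
    1 _ → cong Ω (sym (from-0F p))
    (suc (suc _)) (s≤s (s≤s ()))

  leave-1F : ∀ {i c} → Ω c ≡ 1 → ForcesTo chain i (SamePriority 1F) 1F (SamePriority c)
  leave-1F c≡1 = emptyStrategy , λ p → 1 , trans c≡1 (cong Ω (sym (from-1F p))) , λ where
    0 _ → cong Ω (sym (AllowedPath.start p))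
    (suc _) (s≤s ())

  ¬stay-0F : ∀ {i} → ¬ ForcesStay chain i (SamePriority 0F) 0F
  ¬stay-0F (S , stays) with () ← trans (stays (path 0F) 2) (cong Ω (from-0F² (path {S = S} 0F)))

  ¬stay-1F : ∀ {i} → ¬ ForcesStay chain i (SamePriority 1F) 1F
  ¬stay-1F (S , stays) with () ← trans (stays (path 1F) 1) (cong Ω (from-1F (path {S = S} 1F)))

  stuttering : IsStutteringBisimulation chain SamePriority
  stuttering = record
    { isEquivalence = On.isEquivalence Ω isEquivalence
    ; priority      = λ r → r
    ; leave         = λ {v} {w} r c c≄v (_ , v⟶v′ , c~v′) →
        -- If `c` and `v` were related, their classes would coincide as sets.
        leave v w r c (λ c~v → c≄v (trans (sym c~v) , trans c~v)) v⟶v′ c~v′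
    ; stay          = λ {v} {w} r i → stay v w r
    } , λ _ → refl
    where
    leave : ∀ v w → SamePriority v w → ∀ c → ¬ SamePriority c v →
            ∀ {v′} → v ⟶ v′ → SamePriority c v′ →
            ForcesTo chain ◇ (SamePriority w) w (SamePriority c)
    leave v  0F r 0F c≁v _ _ = ⊥-elim (c≁v (sym r))
    leave v  0F r 1F c≁v _ _ = ⊥-elim (c≁v (sym r))
    leave v  0F r 2F _   _ _ = leave-0F refl
    leave v  1F r 0F c≁v _ _ = ⊥-elim (c≁v (sym r))
    leave v  1F r 1F c≁v _ _ = ⊥-elim (c≁v (sym r))
    leave v  1F r 2F _   _ _ = leave-1F refl
    -- The only edge is the loop, which never leaves the class.
    leave 2F 2F r c  c≁v (here refl) c~v′ = ⊥-elim (c≁v c~v′)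

    stay : ∀ v w → SamePriority v w → ∀ {i} →
           ForcesStay chain i (SamePriority v) v → ForcesStay chain i (SamePriority w) w
    stay 0F _  _ forces = ⊥-elim (¬stay-0F forces)
    stay 1F _  _ forces = ⊥-elim (¬stay-1F forces)
    stay 2F 2F _ forces = forces

  -- Matching the edge `0F` to `1F` would relate `1F` to `2F`, whose priorities differ.
  not-strong : ¬ StronglyBisimilar chain 0F 1F
  not-strong (R , (R-bisim , _) , r) with transfer r (here refl)
    where open IsGovernedBisimulation R-bisim
  ... | _ , here refl , r′ with () ← IsGovernedBisimulation.priority R-bisim r′

-- Two loops that differ only in their owner: neither player has a real choice, so governed
-- bisimilarity cannot tell them apart.
opposed : ParityGame
opposed = game 2 [_] (λ _ → 0) owner
  where
  owner : Fin 2 → Player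
  owner 0F = ◇
  owner 1F = □

opposed-governed : IsGovernedBisimulation opposed (λ _ _ → ⊤)
opposed-governed = record
  { symmetric = λ _ → tt
  ; priority  = λ _ → refl
  ; governed  = λ _ _ _ _ → tt
  ; transfer  = λ {_} {w} _ _ → let w′ , w⟶w′ = ParityGame.total opposed w in w′ , w⟶w′ , tt
  }

opposed-not-strong : ¬ StronglyBisimilar opposed 0F 1F
opposed-not-strong (_ , (_ , sameOwner) , r) with () ← sameOwner r

theorem19 : StrictlyFiner StronglyBisimilar StrongDirectSimulationEquivalent
    × StrictlyFiner StronglyBisimilar StutteringBisimilar
    × StrictlyFiner StronglyBisimilar GovernedBisimilar
theorem19 =
    ( (λ _ _ _ s → strong⇒≤sd s , strong⇒≤sd (stronglyBisimilar-sym s))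
    , dominated , 0F , 1F
    , ( (Dominates , dominates-simulation , 0F≤1F)
      , (Dominates , dominates-simulation , 1F≤0F))
    , dominated-not-strong)
  , ( (λ _ _ _ → strong⇒stutteringBisimilar)
    , chain , 0F , 1F
    , (Chain.SamePriority , Chain.stuttering , refl)
    , Chain.not-strong)
  , ( (λ _ _ _ (R , (R-bisim , _) , r) → R , R-bisim , r)
    , opposed , 0F , 1F
    , ((λ _ _ → ⊤) , opposed-governed , tt)
    , opposed-not-strong)
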